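{- For all positive integers $n,m$, the second player does not win the Peaceable Kings Game $\mathrm{PK}(n,m)$; that is, the first player has a winning strategy.
   Context: The Peaceable Kings Game $\mathrm{PK}(n,m)$ is played on an $n\times m$ chessboard with squares $(x,y)$, $0\leq x\leq n-1$, $0\leq y\leq m-1$. Two players alternately place a king on an unoccupied square; the first player places white kings and the second player places black kings. A player may not place a king on a square within attacking range of a king previously placed by the opponent. A player unable to move on their turn loses. Two distinct squares $(x_1,y_1)$ and $(x_2,y_2)$ are within attacking range for kings iff $|x_1-x_2|\leq 1$ and $|y_1-y_2|\leq 1$. A player "wins" the game if that player has a winning strategy. -}

module Defs where

open import Data.Nat using (ℕ; _≤_; ∣_-_∣)
open import Data.Fin using (Fin; toℕ)
open import Data.List using (List; []; _∷_)
open import Data.List.Membership.Propositional using (_∈_)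
open import Data.Product using (Σ; ∃; ∃-syntax; _×_; _,_)
open import Relation.Binary.PropositionalEquality using (_≡_; _≢_)
open import Relation.Nullary using (¬_)

-- Players are identified with their colour; white is the first player.
data Player : Set where
  white black : Player

opponent : Player → Player
opponent white = black
opponent black = white

module PK (n m : ℕ) where

  Square : Set
  Square = Fin n × Fin m

  Attacks : Square → Square → Set
  Attacks s@(x₁ , y₁) t@(x₂ , y₂) =
    s ≢ t × ∣ toℕ x₁ - toℕ x₂ ∣ ≤ 1 × ∣ toℕ y₁ - toℕ y₂ ∣ ≤ 1

  -- The kings placed so far, most recent first.  The order is kept so that
  -- strategies may depend on the whole history of the play.
  Position : Set
  Position = List (Player × Square)

  toMove : Position → Player
  toMove []            = white
  toMove ((c , _) ∷ _) = opponent c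

  Occupied : Position → Square → Set
  Occupied p s = ∃[ c ] (c , s) ∈ p

  Legal : Position → Square → Set
  Legal p s = ¬ Occupied p s
            × (∀ t → (opponent (toMove p) , t) ∈ p → ¬ Attacks t s)

  CanMove : Position → Set
  CanMove p = ∃ (Legal p)

  -- The value of `choose` matters only where it is c's turn and c can move.
  record Strategy (c : Player) : Set where
    field
      choose : Position → Square
      legal  : ∀ p → toMove p ≡ c → CanMove p → Legal p (choose p)

  open Strategy public

  -- `Play σ p`: p arises from the empty board by legal alternating moves in
  -- which c follows σ and the opponent moves arbitrarily.
  data Play {c : Player} (σ : Strategy c) : Position → Set where
    start : Play σ []
    move  : ∀ {p s} → Play σ p → Legal p s →
            (toMove p ≡ c → s ≡ choose σ p) →
            Play σ ((toMove p , s) ∷ p)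

  -- Every play is finite, as each move occupies a new square; so σ wins when
  -- each play following it that has come to an end was lost by the opponent.
  Winning : {c : Player} → Strategy c → Set
  Winning {c} σ = ∀ {p} → Play σ p → ¬ CanMove p → toMove p ≡ opponent c

  Wins : Player → Set
  Wins c = Σ (Strategy c) Winning

{-# OPTIONS --safe #-}

-- White opens at a central square c and from then on answers every black king
-- by its image under the point reflection of the board.  A reflected king
-- could only be illegal because its square lies within range of the king it
-- answers or is c itself; in both cases the black king would have been within
-- range of c.  So white never runs out of moves, and since every play is
-- finite, black cannot have a winning strategy as well.
module Submission where

open import Defs
open import Data.Fin using (Fin; zero; suc; toℕ; fromℕ<; opposite; combine)
open import Data.Fin.Properties using (toℕ<n; toℕ-fromℕ<; opposite-prop;
  opposite-involutive; any?; all?; combine-injective; injective⇒≤)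
  renaming (_≟_ to _≟ᶠ_)
open import Data.List using ([]; _∷_; length; lookup)
open import Data.List.Membership.Propositional using (_∈_)
open import Data.List.Membership.Propositional.Properties using (∈-lookup)
open import Data.List.Relation.Unary.Any using (here; there)
open import Data.Nat using (ℕ; zero; suc; _+_; _*_; _∸_; _≤_; _<_; z≤n; s≤s;
  NonZero; ∣_-_∣; ⌊_/2⌋; _≤?_)
open import Data.Nat.Properties using (+-suc; +-identityʳ; +-∸-assoc;
  m+[n∸m]≡n; m∸n≤m; m∸[m∸n]≡n; m≤n⇒∣m-n∣≡n∸m; ∣-∣-comm; ∣n-n∣≡0; ⌊n/2⌋<n;
  m≤n+m; <⇒≱)
open import Data.Product using (_×_; _,_; proj₁; proj₂)
open import Data.Product.Properties using (≡-dec)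
open import Data.Sum using (_⊎_; inj₁; inj₂; [_,_])
open import Data.Empty using (⊥)
open import Function.Definitions using (Injective)
open import Relation.Binary.Definitions using (DecidableEquality)
open import Relation.Binary.PropositionalEquality using (_≡_; _≢_; refl;
  sym; trans; cong; cong₂; subst; module ≡-Reasoning)
open import Relation.Nullary using (¬_; Dec; yes; no; contradiction)
open import Relation.Nullary.Decidable using (map′; ¬?; _×-dec_; _⊎-dec_; _→-dec_)

-- Reflection of a single coordinate and its midpoint.

∣-∣-∸ : ∀ {n a b} → a ≤ n → b ≤ n → ∣ n ∸ a - n ∸ b ∣ ≡ ∣ a - b ∣
∣-∣-∸ {n} {b = b} z≤n b≤n = begin
  ∣ n - n ∸ b ∣   ≡⟨ ∣-∣-comm n (n ∸ b) ⟩
  ∣ n ∸ b - n ∣   ≡⟨ m≤n⇒∣m-n∣≡n∸m (m∸n≤m n b) ⟩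
  n ∸ (n ∸ b)     ≡⟨ m∸[m∸n]≡n b≤n ⟩
  b               ∎
  where open ≡-Reasoning
∣-∣-∸ {n} (s≤s {a} a≤n) z≤n =
  trans (m≤n⇒∣m-n∣≡n∸m (m∸n≤m n (suc a))) (m∸[m∸n]≡n (s≤s a≤n))
∣-∣-∸ (s≤s a≤n) (s≤s b≤n) = ∣-∣-∸ a≤n b≤n

-- The halved sum is the midpoint rounded up, which lies between `a` and `b`. Rounding up suits a
-- coordinate and its `opposite`, whose sum is `n - 1`: the midpoint is then `⌊ n /2⌋`.
∣half-∣≤1 : ∀ a b → ∣ a - b ∣ ≤ 1 → ∣ ⌊ suc (a + b) /2⌋ - a ∣ ≤ 1
∣half-∣≤1 zero    zero       _ = z≤n
∣half-∣≤1 zero    (suc zero) _ = s≤s z≤n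
∣half-∣≤1 zero    (suc (suc _)) (s≤s ())
∣half-∣≤1 (suc zero) zero    _ = z≤n
∣half-∣≤1 (suc (suc _)) zero (s≤s ())
∣half-∣≤1 (suc a) (suc b)    h rewrite +-suc a b = ∣half-∣≤1 a b h

∣half-rest∣≤1 : ∀ n → ∣ ⌊ n /2⌋ - n ∸ suc ⌊ n /2⌋ ∣ ≤ 1
∣half-rest∣≤1 zero                = z≤n
∣half-rest∣≤1 (suc zero)          = z≤n
∣half-rest∣≤1 (suc (suc zero))    = s≤s z≤n
-- Adding 2 raises both terms by 1, but only from a positive number on: at 0 the subtraction
-- truncates, so 2 is a base case of its own.
∣half-rest∣≤1 (suc (suc (suc n))) =
  subst (λ d → ∣ suc ⌊ suc n /2⌋ - d ∣ ≤ 1) (sym (+-∸-assoc 1 (⌊n/2⌋<n n)))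
    (∣half-rest∣≤1 (suc n))

Close : ∀ {n} → Fin n → Fin n → Set
Close i j = ∣ toℕ i - toℕ j ∣ ≤ 1

opposite-close : ∀ {n} (i j : Fin n) → Close i j → Close (opposite i) (opposite j)
opposite-close i j
  rewrite opposite-prop i | opposite-prop j | ∣-∣-∸ (toℕ<n i) (toℕ<n j) = λ h → h

middle : ∀ n → .{{NonZero n}} → Fin n
middle (suc n) = fromℕ< (⌊n/2⌋<n n)

toℕ-middle : ∀ n .{{_ : NonZero n}} → toℕ (middle n) ≡ ⌊ n /2⌋
toℕ-middle (suc n) = toℕ-fromℕ< (⌊n/2⌋<n n)

-- For even `n` the reflection moves `middle n`, but only to the adjacent coordinate; for odd `n` it
-- fixes it.
middle-close-opposite : ∀ n .{{_ : NonZero n}} → Close (middle n) (opposite (middle n))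
middle-close-opposite n rewrite opposite-prop (middle n) =
  subst (λ k → ∣ k - n ∸ suc k ∣ ≤ 1) (sym (toℕ-middle n)) (∣half-rest∣≤1 n)

close-opposite⇒close-middle : ∀ {n} .{{_ : NonZero n}} (i : Fin n) →
  Close i (opposite i) → Close (middle n) i
close-opposite⇒close-middle {n} i h =
  subst (λ k → ∣ k - toℕ i ∣ ≤ 1) half (∣half-∣≤1 (toℕ i) (toℕ (opposite i)) h)
  where
  open ≡-Reasoning
  half : ⌊ suc (toℕ i + toℕ (opposite i)) /2⌋ ≡ toℕ (middle n)
  half = begin
    ⌊ suc (toℕ i + toℕ (opposite i)) /2⌋    ≡⟨ cong (λ k → ⌊ suc (toℕ i + k) /2⌋) (opposite-prop i) ⟩
    ⌊ suc (toℕ i) + (n ∸ suc (toℕ i)) /2⌋   ≡⟨ cong ⌊_/2⌋ (m+[n∸m]≡n (toℕ<n i)) ⟩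
    ⌊ n /2⌋                                 ≡⟨ toℕ-middle n ⟨
    toℕ (middle n)                          ∎

-- Decidability of the rules, finiteness of plays, and strategies with a fallback.

_≟ᵖ_ : DecidableEquality Player
white ≟ᵖ white = yes refl
white ≟ᵖ black = no λ ()
black ≟ᵖ white = no λ ()
black ≟ᵖ black = yes refl

module Game (n m : ℕ) where
  open PK n m

  _≟ˢ_ : DecidableEquality Square
  _≟ˢ_ = ≡-dec _≟ᶠ_ _≟ᶠ_

  open import Data.List.Membership.DecPropositional (≡-dec _≟ᵖ_ _≟ˢ_) using (_∈?_)

  attacks? : ∀ s t → Dec (Attacks s t)
  attacks? s t = ¬? (s ≟ˢ t) ×-dec (_ ≤? 1) ×-dec (_ ≤? 1)

  occupied? : ∀ p s → Dec (Occupied p s)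
  occupied? p s = map′
    [ (white ,_) , (black ,_) ]
    (λ where (white , h) → inj₁ h
             (black , h) → inj₂ h)
    ((white , s) ∈? p ⊎-dec (black , s) ∈? p)

  legal? : ∀ p s → Dec (Legal p s)
  legal? p s = ¬? (occupied? p s) ×-dec
    map′ (λ h (x , y) → h x y) (λ h x y → h (x , y))
      (all? λ x → all? λ y →
        ((opponent (toMove p) , x , y) ∈? p) →-dec ¬? (attacks? (x , y) s))

  canMove? : ∀ p → Dec (CanMove p)
  canMove? p = map′ (λ (x , y , h) → (x , y) , h) (λ ((x , y) , h) → x , y , h)
    (any? λ x → any? λ y → legal? p (x , y))

  squares-injective : ∀ {c} {σ : Strategy c} {p} → Play σ p →
    Injective _≡_ _≡_ (λ i → proj₂ (lookup p i))
  squares-injective (move pl l _) {zero}  {zero}  _ = refl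
  squares-injective (move pl l _) {zero}  {suc j} refl =
    contradiction (_ , ∈-lookup j) (proj₁ l)
  squares-injective (move pl l _) {suc i} {zero}  refl =
    contradiction (_ , ∈-lookup i) (proj₁ l)
  squares-injective (move pl l _) {suc i} {suc j} e =
    cong suc (squares-injective pl e)

  length≤area : ∀ {c} {σ : Strategy c} {p} → Play σ p → length p ≤ n * m
  length≤area {p = p} pl = injective⇒≤ {f = λ i → index (proj₂ (lookup p i))}
    λ e → squares-injective pl (index-injective e)
    where
    index : Square → Fin (n * m)
    index (x , y) = combine x y

    index-injective : Injective _≡_ _≡_ index
    index-injective {x , y} {x′ , y′} e
      with refl , refl ← combine-injective x y x′ y′ e = refl

  -- Letting the two strategies meet produces one play that follows both. It must end, and at its
  -- end each strategy claims that the other side is to move.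
  not-both-win : Wins white → ¬ Wins black
  not-both-win (σ , σ-wins) (τ , τ-wins) = go (suc (n * m)) start start (m≤n+m _ 0)
    where
    -- `k` is fuel: each move lengthens `p` and lowers `k` by one, and at 0 the play would have more
    -- kings than the board has squares.
    go : ∀ k {p} → Play σ p → Play τ p → n * m < length p + k → ⊥
    go zero {p} pσ _ bound =
      <⇒≱ (subst (n * m <_) (+-identityʳ (length p)) bound) (length≤area pσ)
    go (suc k) {p} pσ pτ bound with canMove? p
    ... | no stuck = contradiction (trans (sym (σ-wins pσ stuck)) (τ-wins pτ stuck)) λ ()
    ... | yes can  = step (toMove p) refl
      where
      bound′ : n * m < suc (length p) + k
      bound′ = subst (n * m <_) (+-suc (length p) k) bound

      step : ∀ c → toMove p ≡ c → ⊥
      step white e = go k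
        (move pσ (legal σ p e can) λ _ → refl)
        (move pτ (legal σ p e can) λ e′ → contradiction (trans (sym e) e′) λ ())
        bound′
      step black e = go k
        (move pσ (legal τ p e can) λ e′ → contradiction (trans (sym e) e′) λ ())
        (move pτ (legal τ p e can) λ _ → refl)
        bound′

  -- A strategy must answer legally in every position where it is to move and can, even those its
  -- own play never reaches. Where `f` proposes an illegal square, any legal one is taken; the last
  -- clause is a dummy for stuck positions.
  legalise : (Position → Square) → Position → Square
  legalise f p with legal? p (f p) | canMove? p
  ... | yes _ | _           = f p
  ... | no _  | yes (s , _) = s
  ... | no _  | no _        = f p

  legalise-legal : ∀ f p → CanMove p → Legal p (legalise f p)
  legalise-legal f p can with legal? p (f p) | canMove? p
  ... | yes l | _           = l
  ... | no _  | yes (_ , l) = l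
  ... | no _  | no stuck    = contradiction can stuck

  legalise-≡ : ∀ f p → Legal p (f p) → legalise f p ≡ f p
  legalise-≡ f p l with legal? p (f p) | canMove? p
  ... | yes _ | _ = refl
  ... | no ¬l | _ = contradiction l ¬l

  prefer : ∀ {c} → (Position → Square) → Strategy c
  prefer f .choose    = legalise f
  prefer f .legal p _ = legalise-legal f p

-- The mirroring strategy.

module Mirror (n m : ℕ) .{{_ : NonZero n}} .{{_ : NonZero m}} where
  open PK n m
  open Game n m

  mirror : Square → Square
  mirror (x , y) = opposite x , opposite y

  mirror-involutive : ∀ s → mirror (mirror s) ≡ s
  mirror-involutive (x , y) = cong₂ _,_ (opposite-involutive x) (opposite-involutive y)

  -- Point reflection is an involutive isometry. This form turns an attack by an older black king on
  -- White's reply into an attack by that king's white partner on the square being answered.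
  mirror-attacks : ∀ {s t} → Attacks s (mirror t) → Attacks (mirror s) t
  mirror-attacks {s@(x , y)} {t@(x′ , y′)} (s≢t′ , hx , hy) =
    subst (Attacks (mirror s)) (mirror-involutive t)
      ( (λ e → s≢t′ (trans (sym (mirror-involutive s))
                       (trans (cong mirror e) (mirror-involutive (mirror t)))))
      , opposite-close x (opposite x′) hx , opposite-close y (opposite y′) hy )

  centre : Square
  centre = middle n , middle m

  -- The invariant after each white move. `white-mirror` keeps the next reply off white kings, while
  -- `black-mirror` keeps it off older black kings and out of their range.
  record Mirrored (p : Position) : Set where
    field
      black-to-move : toMove p ≡ black
      centre-white  : (white , centre) ∈ p
      white-mirror  : ∀ {t} → (white , t) ∈ p → t ≡ centre ⊎ (black , mirror t) ∈ p
      black-mirror  : ∀ {t} → (black , t) ∈ p → (white , mirror t) ∈ p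

  open Mirrored

  -- A fresh black king has no partner yet, so `replied` keeps the invariant of the position before
  -- it.
  data Reachable : Position → Set where
    initial  : Reachable []
    mirrored : ∀ {p} → Mirrored p → Reachable p
    replied  : ∀ {p s} → Mirrored p → Legal p s → Reachable ((black , s) ∷ p)

  Mirrored-opening : Mirrored ((white , centre) ∷ [])
  Mirrored-opening .black-to-move            = refl
  Mirrored-opening .centre-white             = here refl
  Mirrored-opening .white-mirror (here refl) = inj₁ refl
  Mirrored-opening .black-mirror (here ())

  Mirrored-extend : ∀ {p s} → Mirrored p →
    Mirrored ((white , mirror s) ∷ (black , s) ∷ p)
  Mirrored-extend M .black-to-move = refl
  Mirrored-extend M .centre-white  = there (there (M .centre-white))
  Mirrored-extend {s = s} M .white-mirror (here refl) =
    inj₂ (there (here (cong (black ,_) (mirror-involutive s))))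
  Mirrored-extend M .white-mirror (there (there h)) with M .white-mirror h
  ... | inj₁ e  = inj₁ e
  ... | inj₂ h′ = inj₂ (there (there h′))
  Mirrored-extend M .black-mirror (there (here refl)) = here refl
  Mirrored-extend M .black-mirror (there (there h))   = there (there (M .black-mirror h))

  not-attacked : ∀ {p s} → Mirrored p → Legal p s →
    ∀ t → (white , t) ∈ p → ¬ Attacks t s
  not-attacked M (_ , l) t h =
    l t (subst (λ c → (opponent c , t) ∈ _) (sym (M .black-to-move)) h)

  centre-attacks : ∀ {p s} → Mirrored p → Legal p s →
    Close (middle n) (proj₁ s) → Close (middle m) (proj₂ s) → Attacks centre s
  centre-attacks M l hx hy =
    -- Closeness includes equality, but the centre is occupied.
    (λ { refl → proj₁ l (white , M .centre-white) }) , hx , hy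

  mirror-legal : ∀ {p s} → Mirrored p → Legal p s →
    Legal ((black , s) ∷ p) (mirror s)
  mirror-legal {p} {s} M l = free , safe
    where
    not-near-centre : Close (middle n) (proj₁ s) → Close (middle m) (proj₂ s) → ⊥
    not-near-centre hx hy =
      not-attacked M l centre (M .centre-white) (centre-attacks M l hx hy)

    not-near-mirror : Close (proj₁ s) (opposite (proj₁ s)) →
                      Close (proj₂ s) (opposite (proj₂ s)) → ⊥
    not-near-mirror hx hy = not-near-centre
      (close-opposite⇒close-middle _ hx) (close-opposite⇒close-middle _ hy)

    mirror≢centre : mirror s ≢ centre
    -- Here `s` would be the reflected centre, which coincides with the centre or is adjacent to it.
    mirror≢centre e with refl ← trans (sym (mirror-involutive s)) (cong mirror e) =
      not-near-centre (middle-close-opposite n) (middle-close-opposite m)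

    mirror≢self : mirror s ≢ s
    mirror≢self e = not-near-mirror (self (cong proj₁ e)) (self (cong proj₂ e))
      where
      self : ∀ {k} {i : Fin k} → opposite i ≡ i → Close i (opposite i)
      self {i = i} e rewrite e | ∣n-n∣≡0 (toℕ i) = z≤n

    free : ¬ Occupied ((black , s) ∷ p) (mirror s)
    free (_ , here e) = mirror≢self (cong proj₂ e)
    free (white , there h) with M .white-mirror h
    ... | inj₁ e  = mirror≢centre e
    -- The partner of a white king on `mirror s` would be a black king already standing on `s`.
    ... | inj₂ h′ =
      proj₁ l (black , subst (λ t → (black , t) ∈ p) (mirror-involutive s) h′)
    free (black , there h) = proj₁ l
      (white , subst (λ t → (white , t) ∈ p) (mirror-involutive s) (M .black-mirror h))

    safe : ∀ t → (black , t) ∈ (black , s) ∷ p → ¬ Attacks t (mirror s)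
    safe t (here refl) (_ , hx , hy) = not-near-mirror hx hy
    safe t (there h) a =
      not-attacked M l (mirror t) (M .black-mirror h) (mirror-attacks a)

  centre-legal : Legal [] centre
  centre-legal = (λ ()) , λ _ ()

  reply : Position → Square
  reply []            = centre
  reply ((_ , s) ∷ _) = mirror s

  mirroring : Strategy white
  mirroring = prefer reply

  -- Along such a play the fallback of `legalise` is never taken, since the preferred reply is legal
  -- at each white turn; hence `legalise-≡` identifies White's move.
  reachable : ∀ {p} → Play mirroring p → Reachable p
  reachable start = initial
  reachable (move {p} {s} pl l follows) with reachable pl
  ... | initial = subst (λ t → Reachable ((white , t) ∷ p))
    (sym (trans (follows refl) (legalise-≡ reply p centre-legal)))
    (mirrored Mirrored-opening)
  ... | mirrored M = subst (λ c → Reachable ((c , s) ∷ p))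
    (sym (M .black-to-move))
    (replied M l)
  ... | replied M l′ = subst (λ t → Reachable ((white , t) ∷ p))
    (sym (trans (follows refl) (legalise-≡ reply p (mirror-legal M l′))))
    (mirrored (Mirrored-extend M))

  mirroring-wins : Winning mirroring
  mirroring-wins pl stuck with reachable pl
  ... | initial      = contradiction (centre , centre-legal) stuck
  ... | mirrored M   = M .black-to-move
  ... | replied M l  = contradiction (_ , mirror-legal M l) stuck

  white-wins : Wins white
  white-wins = mirroring , mirroring-wins

theorem5p1 : ∀ (n m : ℕ) → .{{_ : NonZero n}} → .{{_ : NonZero m}} →
    ¬ PK.Wins n m black × PK.Wins n m white
theorem5p1 n m = Game.not-both-win n m white-wins , white-wins
  where open Mirror n m using (white-wins)
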